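{- For all positive integers $n,k$ with $k\le n$, \[ \overline{M}_k(n)=\sum_{d\mid n}\varphi(d)\sum_{\substack{\delta\mid n\\ \gcd(\delta,d)=1}}\mu(\delta)\sum_{\substack{1\le j\le n/\delta\\ \delta j\equiv 1 \ (\mathrm{mod}\ d)}} f_k\!\left(\left\lfloor \frac{n}{j\delta}\right\rfloor\right), \] where $d$ and $\delta$ run over the positive divisors of $n$, and for $d=1$ the congruence condition is vacuous.
   Context: For a nonempty finite set $A$ of positive integers, $(A)$ denotes the greatest common divisor of the elements of $A$. $\varphi$ is Euler's totient function and $\mu$ is the Möbius function. For $m,k\in\mathbb{N}$, $f_k(m)$ is the number of $k$-element subsets $A\subseteq\{1,2,\ldots,m\}$ with $(A)=1$ (so $f_k(m)=0$ if $m<k$; equivalently $f_k(m)=\sum_{d=1}^m\mu(d)\binom{\lfloor m/d\rfloor}{k}$). For $1\le k\le n$ define \[ \overline{M}_k(n)=\sum_{\substack{A\subseteq\{1,\ldots,n\},\ \#A=k\\ \gcd((A),n)=1}}\gcd((A)-1,n), \] the sum over all $k$-element subsets $A$ of $\{1,\ldots,n\}$ with $\gcd((A),n)=1$, with the convention $\gcd(0,n)=n$. -}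

module Defs where

open import Data.Bool.Base using (if_then_else_)
open import Data.Fin.Base using (toℕ)
open import Data.Fin.Subset using (Subset; inside; outside; ∣_∣)
open import Data.Fin.Subset.Properties using (_∈?_)
open import Data.Integer.Base as ℤ using (ℤ; 0ℤ; -1ℤ)
open import Data.List.Base using (List; [_]; _++_; map; filter; foldr; length; upTo; allFin)
open import Data.List.Relation.Unary.Any using (any?)
open import Data.Nat.Base using (ℕ; zero; suc; _*_; _∸_; NonZero; ∣_-_∣)
open import Data.Nat.Divisibility using (_∣_; _∣?_)
open import Data.Nat.GCD using (gcd)
open import Data.Nat.ListAction using (sum)
open import Data.Nat.Primality using (prime?)
open import Data.Nat.Properties using (_≟_)
import Data.Vec.Base as Vec
open import Relation.Nullary.Decidable using (Dec; does; _×-dec_)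
open import Relation.Unary using (Pred; Decidable)

[1⋯_] : ℕ → List ℕ
[1⋯ m ] = map suc (upTo m)

-- ∑ m P? g is the sum of g j over those 1 ≤ j ≤ m that satisfy P.
∑ : ∀ {p} (m : ℕ) {P : Pred ℕ p} → Decidable P →
    ((j : ℕ) → .{{NonZero j}} → ℤ) → ℤ
∑ m P? g =
  foldr ℤ._+_ 0ℤ (map (λ i → g (suc i)) (filter (λ i → P? (suc i)) (upTo m)))

infix 4 _≡_[mod_] _≡?_[mod_]

_≡_[mod_] : ℕ → ℕ → ℕ → Set
a ≡ b [mod d ] = d ∣ ∣ a - b ∣

_≡?_[mod_] : ∀ a b d → Dec (a ≡ b [mod d ])
a ≡? b [mod d ] = d ∣? ∣ a - b ∣

φ : ℕ → ℕ
φ n = length (filter (λ a → gcd a n ≟ 1) [1⋯ n ])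

primeDivisors : ℕ → List ℕ
primeDivisors n = filter (λ p → prime? p ×-dec p ∣? n) [1⋯ n ]

-- Intended for n ≥ 1 only.
μ : ℕ → ℤ
μ n = if does (any? (λ p → p * p ∣? n) (primeDivisors n))
      then 0ℤ
      else -1ℤ ℤ.^ length (primeDivisors n)

-- A : Subset m stands for a subset of {1, …, m}: the index i : Fin m
-- represents the integer suc (toℕ i).
elements : ∀ {m} → Subset m → List ℕ
elements {m} A = map (λ i → suc (toℕ i)) (filter (_∈? A) (allFin m))

-- The gcd (A) of the elements of A; the empty set, where (A) is not
-- defined, gets the value 0.
gcdSet : ∀ {m} → Subset m → ℕ
gcdSet A = foldr gcd 0 (elements A)

subsets : ∀ m → List (Subset m)
subsets zero    = [ Vec.[] ]
subsets (suc m) = map (outside Vec.∷_) (subsets m) ++ map (inside Vec.∷_) (subsets m)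

subsetsOfSize : ℕ → ∀ m → List (Subset m)
subsetsOfSize k m = filter (λ A → ∣ A ∣ ≟ k) (subsets m)

f : ℕ → ℕ → ℕ
f k m = length (filter (λ A → gcdSet A ≟ 1) (subsetsOfSize k m))

-- For k ≥ 1 every A occurring here has (A) ≥ 1, so ∸ does not truncate;
-- gcd 0 n = n.
M̄ : ℕ → ℕ → ℕ
M̄ k n = sum (map (λ A → gcd (gcdSet A ∸ 1) n)
                  (filter (λ A → gcd (gcdSet A) n ≟ 1) (subsetsOfSize k n)))

{-# OPTIONS --safe #-}

-- The k-subsets A of {1, …, n} with (A) = g are the sets g B with B ⊆ {1, …, ⌊n/g⌋}
-- and (B) = 1, so M̄_k(n) is the sum of gcd(g − 1, n) f_k(⌊n/g⌋) over the g ≤ n prime to n.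
-- Write gcd(g − 1, n) as the sum of φ(d) over d ∣ gcd(g − 1, n), and the condition
-- gcd(g, n) = 1 as the sum of μ(δ) over δ ∣ gcd(g, n); then interchange the sums and
-- put g = δ j.

module Submission where

open import Defs
open import Algebra.Properties.CommutativeSemigroup as CommutativeSemigroup using ()
open import Data.Bool.Base using (true; false; if_then_else_)
open import Data.Fin.Base using (Fin; toℕ) renaming (suc to fsuc)
open import Data.Fin.Subset using (Subset; inside; outside) renaming (∣_∣ to ∥_∥)
open import Data.Fin.Properties using (toℕ<n)
open import Data.Fin.Subset.Properties using (_∈?_)
open import Data.Integer.Base using (ℤ; +_; 0ℤ; 1ℤ; -1ℤ) renaming (_+_ to _+ᶻ_; _*_ to _*ᶻ_; _^_ to _^ᶻ_; -_ to -ᶻ_)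
import Data.Integer.Properties as ℤₚ
open import Data.Integer.Solver using (module +-*-Solver)
open import Data.List.Base using (List; []; _∷_; [_]; _++_; _∷ʳ_; map; filter; foldr; length; upTo; allFin; tabulate)
open import Data.List.Membership.Propositional using (_∈_; find; lose)
open import Data.List.Membership.Propositional.Properties using (∈-map⁺; ∈-map⁻; ∈-upTo⁺; ∈-upTo⁻; ∈-filter⁺; ∈-filter⁻)
open import Data.List.Properties using (++-identityʳ; map-++; map-∘; map-cong; map-applyUpTo; upTo-∷ʳ; filter-++; filter-accept; filter-reject; map-tabulate; length-map)
open import Data.List.Relation.Unary.All as All using (All; []; _∷_; all?)
open import Data.List.Relation.Unary.Any using (Any; here; there; any?)
open import Data.Nat.Base using (ℕ; zero; suc; _+_; _≤_; _<_; _*_; _/_; _%_; _∸_; NonZero; ≢-nonZero; ≢-nonZero⁻¹; >-nonZero; _≤′_; ≤′-refl; ≤′-step; z≤n; s≤s; s≤s⁻¹; >-nonZero⁻¹; ∣_-_∣)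
open import Data.Nat.Coprimality using (Coprime; coprime-divisor; coprime⇒gcd≡1)
open import Data.Nat.Divisibility
open import Data.Nat.DivMod using (m≡m%n+[m/n]*n; m%n<n; m*n/n≡m)
open import Data.Nat.GCD
open import Data.Nat.ListAction using (sum; product)
open import Data.Nat.Primality
open import Data.Nat.Primality.Factorisation using (factorise)
open import Data.Nat.Properties as ℕₚ using (_≟_; m*n≢0)
open import Data.Product.Base using (_×_; _,_; proj₁; proj₂; ∃)
open import Data.Sum.Base using (inj₁; inj₂; reduce)
open import Data.Vec.Base as Vec using ()
open import Function.Base using (_∘_; id)
open import Level using (Level)
open import Relation.Binary.PropositionalEquality using (_≡_; _≢_; refl; sym; trans; cong; cong₂; subst; module ≡-Reasoning)
open import Relation.Nullary using (¬_; contradiction)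
open import Relation.Nullary.Decidable using (Dec; yes; no; does; _×-dec_; ¬?)
open import Relation.Unary using (Pred; Decidable)

open CommutativeSemigroup ℤₚ.+-commutativeSemigroup using () renaming (interchange to +-interchange)
open CommutativeSemigroup ℤₚ.*-commutativeSemigroup using (x∙yz≈y∙xz; x∙yz≈zy∙x)
open +-*-Solver using (solve; _:=_; _:*_)
open ≡-Reasoning

-- The ranges in the formula depend on one another: j stops at n / δ, and δ is restricted by d. So
-- every condition becomes a 0/1 weight and every sum runs over {1, ..., n}, where sums can be
-- exchanged freely. This loses no divisors, because gcd(g - 1, n) and gcd(g, n) are both positive
-- and at most n; at g = 1 the first is gcd(0, n) = n, as the convention asks. The calculation
-- starts from the right-hand side. The gain from fixing g is that the conditions on d and δ
-- decouple into d ∣ gcd(g - 1, n) and δ ∣ gcd(g, n), so the double sum is a product of the two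
-- classical divisor sums.

private variable
  a p q : Level
  A B : Set a
  P : Set p
  Q : Set q

-- Indicators and finite sums of integers

𝟙 : Dec P → ℤ
𝟙 P? = if does P? then 1ℤ else 0ℤ

𝟙-true : (P? : Dec P) → P → 𝟙 P? ≡ 1ℤ
𝟙-true (yes _) _  = refl
𝟙-true (no ¬x) x = contradiction x ¬x

𝟙-false : (P? : Dec P) → ¬ P → 𝟙 P? ≡ 0ℤ
𝟙-false (yes x) ¬x = contradiction x ¬x
𝟙-false (no _)  _  = refl

𝟙-cong : (P? : Dec P) (Q? : Dec Q) → (P → Q) → (Q → P) → 𝟙 P? ≡ 𝟙 Q?
𝟙-cong (yes x) Q? to from = sym (𝟙-true Q? (to x))
𝟙-cong (no ¬x) Q? to from = sym (𝟙-false Q? (¬x ∘ from))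

𝟙-× : (P? : Dec P) (Q? : Dec Q) → 𝟙 (P? ×-dec Q?) ≡ 𝟙 P? *ᶻ 𝟙 Q?
𝟙-× (yes _) Q? = sym (ℤₚ.*-identityˡ (𝟙 Q?))
𝟙-× (no _)  Q? = refl

𝟙-*-cong : (P? : Dec P) {x y : ℤ} → (P → x ≡ y) → 𝟙 P? *ᶻ x ≡ 𝟙 P? *ᶻ y
𝟙-*-cong (yes x) eq = cong (1ℤ *ᶻ_) (eq x)
𝟙-*-cong (no _)  eq = refl

sumOver : List A → (A → ℤ) → ℤ
sumOver xs h = foldr _+ᶻ_ 0ℤ (map h xs)

infix 5 sumOver
syntax sumOver xs (λ x → e) = ∑[ x ← xs ] e

∑-cong∈ : (xs : List A) {g h : A → ℤ} → (∀ {x} → x ∈ xs → g x ≡ h x) → sumOver xs g ≡ sumOver xs h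
∑-cong∈ []       eq = refl
∑-cong∈ (x ∷ xs) eq = cong₂ _+ᶻ_ (eq (here refl)) (∑-cong∈ xs (eq ∘ there))

∑-cong : (xs : List A) {g h : A → ℤ} → (∀ x → g x ≡ h x) → sumOver xs g ≡ sumOver xs h
∑-cong xs eq = ∑-cong∈ xs (λ {x} _ → eq x)

∑-zero : (xs : List A) → (∑[ x ← xs ] 0ℤ) ≡ 0ℤ
∑-zero []       = refl
∑-zero (x ∷ xs) = trans (ℤₚ.+-identityˡ _) (∑-zero xs)

∑-distrib-+ : (xs : List A) (g h : A → ℤ) → (∑[ x ← xs ] (g x +ᶻ h x)) ≡ sumOver xs g +ᶻ sumOver xs h
∑-distrib-+ []       g h = refl
∑-distrib-+ (x ∷ xs) g h = trans (cong ((g x +ᶻ h x) +ᶻ_) (∑-distrib-+ xs g h)) (+-interchange (g x) (h x) _ _)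

∑-distribˡ : (c : ℤ) (xs : List A) (h : A → ℤ) → c *ᶻ sumOver xs h ≡ (∑[ x ← xs ] c *ᶻ h x)
∑-distribˡ c []       h = ℤₚ.*-zeroʳ c
∑-distribˡ c (x ∷ xs) h = trans (ℤₚ.*-distribˡ-+ c (h x) _) (cong (c *ᶻ h x +ᶻ_) (∑-distribˡ c xs h))

∑-swap : (xs : List A) (ys : List B) (h : A → B → ℤ) →
         (∑[ x ← xs ] ∑[ y ← ys ] h x y) ≡ (∑[ y ← ys ] ∑[ x ← xs ] h x y)
∑-swap []       ys h = sym (∑-zero ys)
∑-swap (x ∷ xs) ys h = trans (cong (sumOver ys (h x) +ᶻ_) (∑-swap xs ys h)) (sym (∑-distrib-+ ys (h x) _))

∑-++ : (xs ys : List A) (h : A → ℤ) → sumOver (xs ++ ys) h ≡ sumOver xs h +ᶻ sumOver ys h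
∑-++ []       ys h = sym (ℤₚ.+-identityˡ _)
∑-++ (x ∷ xs) ys h = trans (cong (h x +ᶻ_) (∑-++ xs ys h)) (sym (ℤₚ.+-assoc (h x) _ _))

∑-map : (e : A → B) (xs : List A) (h : B → ℤ) → sumOver (map e xs) h ≡ sumOver xs (h ∘ e)
∑-map e xs h = cong (foldr _+ᶻ_ 0ℤ) (sym (map-∘ xs))

∑-filter : {P : Pred A p} (P? : Decidable P) (xs : List A) (h : A → ℤ) →
           sumOver (filter P? xs) h ≡ (∑[ x ← xs ] 𝟙 (P? x) *ᶻ h x)
∑-filter P? []       h = refl
∑-filter P? (x ∷ xs) h with P? x
... | yes _ = cong₂ _+ᶻ_ (sym (ℤₚ.*-identityˡ (h x))) (∑-filter P? xs h)
... | no  _ = trans (∑-filter P? xs h) (sym (ℤₚ.+-identityˡ _))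

length-filter-∑ : {P : Pred A p} (P? : Decidable P) (xs : List A) →
                  + length (filter P? xs) ≡ (∑[ x ← xs ] 𝟙 (P? x))
length-filter-∑ P? []       = refl
length-filter-∑ P? (x ∷ xs) with P? x
... | yes _ = cong (1ℤ +ᶻ_) (length-filter-∑ P? xs)
... | no  _ = trans (length-filter-∑ P? xs) (sym (ℤₚ.+-identityˡ _))

+sum≡∑ : (xs : List A) (h : A → ℕ) → + sum (map h xs) ≡ (∑[ x ← xs ] + h x)
+sum≡∑ []       h = refl
+sum≡∑ (x ∷ xs) h = cong (+ h x +ᶻ_) (+sum≡∑ xs h)

-- Sums over [1⋯ n ]

[1⋯suc_] : ∀ n → [1⋯ suc n ] ≡ [1⋯ n ] ∷ʳ suc n
[1⋯suc n ] = trans (cong (map suc) (sym (upTo-∷ʳ n))) (map-++ suc (upTo n) [ n ])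

∑-suc : ∀ n (h : ℕ → ℤ) → sumOver [1⋯ suc n ] h ≡ sumOver [1⋯ n ] h +ᶻ h (suc n)
∑-suc n h = begin
  sumOver [1⋯ suc n ] h                  ≡⟨ cong (λ xs → sumOver xs h) [1⋯suc n ] ⟩
  sumOver ([1⋯ n ] ∷ʳ suc n) h           ≡⟨ ∑-++ [1⋯ n ] [ suc n ] h ⟩
  sumOver [1⋯ n ] h +ᶻ (h (suc n) +ᶻ 0ℤ) ≡⟨ cong (sumOver [1⋯ n ] h +ᶻ_) (ℤₚ.+-identityʳ _) ⟩
  sumOver [1⋯ n ] h +ᶻ h (suc n)         ∎

∈-[1⋯]⁺ : ∀ {j n} → 1 ≤ j → j ≤ n → j ∈ [1⋯ n ]
∈-[1⋯]⁺ {suc j} _ j<n = ∈-map⁺ suc (∈-upTo⁺ j<n)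

∈-[1⋯]⁻ : ∀ {j n} → j ∈ [1⋯ n ] → 1 ≤ j × j ≤ n
∈-[1⋯]⁻ j∈ with _ , i∈ , refl ← ∈-map⁻ suc j∈ = s≤s z≤n , ∈-upTo⁻ i∈

-- Induction on `m ≤′ n` removes the top term, which is the one that `∑-suc` exposes.
∑-truncate : ∀ {m n} (h : ℕ → ℤ) → m ≤ n → (∀ j → m < j → h j ≡ 0ℤ) → sumOver [1⋯ n ] h ≡ sumOver [1⋯ m ] h
∑-truncate {m} h m≤n vanish = go (ℕₚ.≤⇒≤′ m≤n)
  where
  go : ∀ {n} → m ≤′ n → sumOver [1⋯ n ] h ≡ sumOver [1⋯ m ] h
  go ≤′-refl = refl
  go {suc n} (≤′-step m≤′n) = begin
    sumOver [1⋯ suc n ] h          ≡⟨ ∑-suc n h ⟩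
    sumOver [1⋯ n ] h +ᶻ h (suc n) ≡⟨ cong₂ _+ᶻ_ (go m≤′n) (vanish (suc n) (s≤s (ℕₚ.≤′⇒≤ m≤′n))) ⟩
    sumOver [1⋯ m ] h +ᶻ 0ℤ        ≡⟨ ℤₚ.+-identityʳ _ ⟩
    sumOver [1⋯ m ] h              ∎

∑-delta : ∀ {n i} (h : ℕ → ℤ) → 1 ≤ i → i ≤ n → (∑[ j ← [1⋯ n ] ] 𝟙 (i ≟ j) *ᶻ h j) ≡ h i
∑-delta {n} {suc i} h _ i<n = begin
  sumOver [1⋯ n ] g              ≡⟨ ∑-truncate g i<n (λ j i<j → vanish (ℕₚ.<⇒≢ i<j)) ⟩
  sumOver [1⋯ suc i ] g          ≡⟨ ∑-suc i g ⟩
  sumOver [1⋯ i ] g +ᶻ g (suc i) ≡⟨ cong₂ _+ᶻ_ below at ⟩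
  0ℤ +ᶻ h (suc i)                ≡⟨ ℤₚ.+-identityˡ _ ⟩
  h (suc i)                      ∎
  where
  g : ℕ → ℤ
  g j = 𝟙 (suc i ≟ j) *ᶻ h j
  vanish : ∀ {j} → suc i ≢ j → g j ≡ 0ℤ
  vanish {j} i≢j = cong (_*ᶻ h j) (𝟙-false (suc i ≟ j) i≢j)
  below : sumOver [1⋯ i ] g ≡ 0ℤ
  below = trans (∑-cong∈ [1⋯ i ] (λ j∈ → vanish (ℕₚ.>⇒≢ (s≤s (proj₂ (∈-[1⋯]⁻ j∈)))))) (∑-zero [1⋯ i ])
  at : g (suc i) ≡ h (suc i)
  at = trans (cong (_*ᶻ h (suc i)) (𝟙-true (suc i ≟ suc i) refl)) (ℤₚ.*-identityˡ _)

-- Total division, so that summands over [1⋯ n ] need no NonZero instance.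
infixl 7 _÷_
_÷_ : ℕ → ℕ → ℕ
m ÷ zero  = 0
m ÷ suc d = m / suc d

÷≡/ : ∀ m d .{{_ : NonZero d}} → m ÷ d ≡ m / d
÷≡/ m (suc d) = refl

-- The bridge from the sums of the statement, filtered and with summands that take a `NonZero`
-- instance, to total summands weighted by indicators. Agreement is asked only at successors, where
-- the instance exists.
∑≡∑[1⋯] : ∀ m {P : Pred ℕ p} (P? : Decidable P) (g : (j : ℕ) → .{{NonZero j}} → ℤ) (h : ℕ → ℤ) →
          (∀ i → g (suc i) ≡ h (suc i)) → ∑ m P? g ≡ (∑[ j ← [1⋯ m ] ] 𝟙 (P? j) *ᶻ h j)
∑≡∑[1⋯] m P? g h eq = begin
  sumOver (filter (λ i → P? (suc i)) (upTo m)) (λ i → g (suc i)) ≡⟨ ∑-cong (filter (λ i → P? (suc i)) (upTo m)) eq ⟩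
  sumOver (filter (λ i → P? (suc i)) (upTo m)) (h ∘ suc)         ≡⟨ ∑-filter (λ i → P? (suc i)) (upTo m) (h ∘ suc) ⟩
  (∑[ i ← upTo m ] 𝟙 (P? (suc i)) *ᶻ h (suc i))                  ≡⟨ ∑-map suc (upTo m) (λ j → 𝟙 (P? j) *ᶻ h j) ⟨
  (∑[ j ← [1⋯ m ] ] 𝟙 (P? j) *ᶻ h j)                             ∎

-- Writing the bound as a quotient and a remainder lets the induction lower it by one each time. For
-- r > 0 the top number is no multiple and is dropped. For r = 0 and a positive quotient the top
-- number is itself a multiple, and the block below is entered at its largest remainder d.
multiples : ∀ q d r → r ≤ d → filter (suc d ∣?_) [1⋯ q * suc d + r ] ≡ map (suc d *_) [1⋯ q ]
multiples zero    d zero    _   = refl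
multiples (suc q) d zero    _   = begin
  filter D? [1⋯ suc q * suc d + 0 ]                                ≡⟨ cong (λ m → filter D? [1⋯ m ]) last ⟩
  filter D? [1⋯ suc (q * suc d + d) ]                              ≡⟨ cong (filter D?) [1⋯suc (q * suc d + d) ] ⟩
  filter D? ([1⋯ q * suc d + d ] ∷ʳ suc (q * suc d + d))           ≡⟨ filter-++ D? [1⋯ q * suc d + d ] _ ⟩
  filter D? [1⋯ q * suc d + d ] ++ filter D? [ suc (q * suc d + d) ] ≡⟨ cong₂ _++_ (multiples q d d ℕₚ.≤-refl) (filter-accept D? divisible) ⟩
  map (suc d *_) [1⋯ q ] ++ [ suc (q * suc d + d) ]                ≡⟨ cong (λ m → map (suc d *_) [1⋯ q ] ++ [ m ]) (trans (sym last) (trans (ℕₚ.+-identityʳ _) (ℕₚ.*-comm (suc q) (suc d)))) ⟩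
  map (suc d *_) [1⋯ q ] ++ [ suc d * suc q ]                      ≡⟨ map-++ (suc d *_) [1⋯ q ] [ suc q ] ⟨
  map (suc d *_) ([1⋯ q ] ∷ʳ suc q)                                ≡⟨ cong (map (suc d *_)) [1⋯suc q ] ⟨
  map (suc d *_) [1⋯ suc q ]                                       ∎
  where
  D? : Decidable (suc d ∣_)
  D? = suc d ∣?_
  last : suc q * suc d + 0 ≡ suc (q * suc d + d)
  last = trans (ℕₚ.+-identityʳ _) (cong suc (ℕₚ.+-comm d (q * suc d)))
  divisible : suc d ∣ suc (q * suc d + d)
  divisible = divides (suc q) (trans (sym last) (ℕₚ.+-identityʳ _))
multiples q       d (suc r) r<d = begin
  filter D? [1⋯ q * suc d + suc r ]                                ≡⟨ cong (λ m → filter D? [1⋯ m ]) last ⟩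
  filter D? [1⋯ suc (q * suc d + r) ]                              ≡⟨ cong (filter D?) [1⋯suc (q * suc d + r) ] ⟩
  filter D? ([1⋯ q * suc d + r ] ∷ʳ suc (q * suc d + r))           ≡⟨ filter-++ D? [1⋯ q * suc d + r ] _ ⟩
  filter D? [1⋯ q * suc d + r ] ++ filter D? [ suc (q * suc d + r) ] ≡⟨ cong₂ _++_ (multiples q d r (ℕₚ.<⇒≤ r<d)) (filter-reject D? indivisible) ⟩
  map (suc d *_) [1⋯ q ] ++ []                                     ≡⟨ ++-identityʳ _ ⟩
  map (suc d *_) [1⋯ q ]                                           ∎
  where
  D? : Decidable (suc d ∣_)
  D? = suc d ∣?_
  last : q * suc d + suc r ≡ suc (q * suc d + r)
  last = ℕₚ.+-suc (q * suc d) r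
  indivisible : ¬ suc d ∣ suc (q * suc d + r)
  indivisible d∣ = >⇒∤ (s≤s r<d) (∣m+n∣m⇒∣n (subst (suc d ∣_) (sym last) d∣) (n∣m*n q))

filter-multiples : ∀ n d .{{_ : NonZero d}} → filter (d ∣?_) [1⋯ n ] ≡ map (d *_) [1⋯ n / d ]
filter-multiples n d@(suc d′) = trans (cong (λ m → filter (d ∣?_) [1⋯ m ]) (trans (m≡m%n+[m/n]*n n d) (ℕₚ.+-comm (n % d) _)))
                                      (multiples (n / d) d′ (n % d) (s≤s⁻¹ (m%n<n n d)))

-- The one change of variables of the proof: it serves for a = e b in `count-gcd`, for d = p e in
-- the Möbius sum and for g = δ j in the theorem.
∑-multiples : ∀ n d .{{_ : NonZero d}} (h : ℕ → ℤ) →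
              (∑[ g ← [1⋯ n ] ] 𝟙 (d ∣? g) *ᶻ h g) ≡ (∑[ j ← [1⋯ n / d ] ] h (d * j))
∑-multiples n d h = begin
  (∑[ g ← [1⋯ n ] ] 𝟙 (d ∣? g) *ᶻ h g)  ≡⟨ ∑-filter (d ∣?_) [1⋯ n ] h ⟨
  sumOver (filter (d ∣?_) [1⋯ n ]) h     ≡⟨ cong (λ xs → sumOver xs h) (filter-multiples n d) ⟩
  sumOver (map (d *_) [1⋯ n / d ]) h     ≡⟨ ∑-map (d *_) [1⋯ n / d ] h ⟩
  (∑[ j ← [1⋯ n / d ] ] h (d * j))       ∎

-- Divisor sums of φ

∑-one : ∀ n → (∑[ a ← [1⋯ n ] ] 1ℤ) ≡ + n
∑-one zero    = refl
∑-one (suc n) = begin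
  (∑[ a ← [1⋯ suc n ] ] 1ℤ)    ≡⟨ ∑-suc n (λ _ → 1ℤ) ⟩
  (∑[ a ← [1⋯ n ] ] 1ℤ) +ᶻ 1ℤ  ≡⟨ cong (_+ᶻ 1ℤ) (∑-one n) ⟩
  + (n + 1)                    ≡⟨ cong +_ (ℕₚ.+-comm n 1) ⟩
  + suc n                      ∎

-- No divisor of m exceeds m. The free bound `N` lets the divisor sums of different gcds share the
-- range {1, ..., n}.
∑-divisors-truncate : ∀ {m N} (h : ℕ → ℤ) → 1 ≤ m → m ≤ N →
                      (∑[ d ← [1⋯ N ] ] 𝟙 (d ∣? m) *ᶻ h d) ≡ (∑[ d ← [1⋯ m ] ] 𝟙 (d ∣? m) *ᶻ h d)
∑-divisors-truncate {m} h 1≤m m≤N = ∑-truncate _ m≤N (λ d m<d → cong (_*ᶻ h d) (𝟙-false (d ∣? m) (>⇒∤ {{>-nonZero 1≤m}} m<d)))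

φ-∑ : ∀ d → + φ d ≡ (∑[ b ← [1⋯ d ] ] 𝟙 (gcd b d ≟ 1))
φ-∑ d = length-filter-∑ (λ b → gcd b d ≟ 1) [1⋯ d ]

-- The a ≤ m with m / gcd(a, m) = d are the multiples e b of e = m / d with gcd(b, d) = 1.
count-gcd : ∀ d m .{{_ : NonZero d}} .{{_ : NonZero m}} →
            (∑[ a ← [1⋯ m ] ] 𝟙 (d * gcd a m ≟ m)) ≡ 𝟙 (d ∣? m) *ᶻ + φ d
count-gcd d m with d ∣? m
... | no d∤m = trans (∑-cong [1⋯ m ] (λ a → 𝟙-false (d * gcd a m ≟ m) (λ eq → d∤m (subst (d ∣_) eq (m∣m*n (gcd a m))))))
                     (∑-zero [1⋯ m ])
... | yes (divides e refl) = begin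
  (∑[ a ← [1⋯ m ] ] 𝟙 (d * gcd a m ≟ m))
    ≡⟨ ∑-cong [1⋯ m ] (λ a → trans (𝟙-cong (d * gcd a m ≟ m) (e ∣? a ×-dec d * gcd a m ≟ m) (λ eq → e∣a a eq , eq) proj₂) (𝟙-× (e ∣? a) (d * gcd a m ≟ m))) ⟩
  (∑[ a ← [1⋯ m ] ] 𝟙 (e ∣? a) *ᶻ 𝟙 (d * gcd a m ≟ m))
    ≡⟨ ∑-multiples m e (λ a → 𝟙 (d * gcd a m ≟ m)) ⟩
  (∑[ b ← [1⋯ m / e ] ] 𝟙 (d * gcd (e * b) m ≟ m))
    ≡⟨ cong (λ r → ∑[ b ← [1⋯ r ] ] 𝟙 (d * gcd (e * b) m ≟ m)) m/e≡d ⟩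
  (∑[ b ← [1⋯ d ] ] 𝟙 (d * gcd (e * b) m ≟ m))
    ≡⟨ ∑-cong [1⋯ d ] (λ b → 𝟙-cong (d * gcd (e * b) m ≟ m) (gcd b d ≟ 1)
         (λ eq → ℕₚ.*-cancelˡ-≡ (gcd b d) 1 m (trans (sym (scale b)) (trans eq (sym (ℕₚ.*-identityʳ m)))))
         (λ eq → trans (scale b) (trans (cong (m *_) eq) (ℕₚ.*-identityʳ m)))) ⟩
  (∑[ b ← [1⋯ d ] ] 𝟙 (gcd b d ≟ 1))
    ≡⟨ φ-∑ d ⟨
  + φ d
    ≡⟨ ℤₚ.*-identityˡ (+ φ d) ⟨
  1ℤ *ᶻ + φ d ∎
  where
  instance
    e≢0 : NonZero e
    e≢0 = ℕₚ.m*n≢0⇒m≢0 e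
  e∣a : ∀ a → d * gcd a m ≡ m → e ∣ a
  e∣a a eq = subst (_∣ a) (ℕₚ.*-cancelˡ-≡ (gcd a m) e d (trans eq (ℕₚ.*-comm e d))) (gcd[m,n]∣m a m)
  m/e≡d : m / e ≡ d
  m/e≡d = trans (cong (λ x → x / e) (ℕₚ.*-comm e d)) (m*n/n≡m d e)
  scale : ∀ b → d * gcd (e * b) m ≡ m * gcd b d
  scale b = begin
    d * gcd (e * b) (e * d) ≡⟨ cong (d *_) (c*gcd[m,n]≡gcd[cm,cn] e b d) ⟨
    d * (e * gcd b d)       ≡⟨ ℕₚ.*-assoc d e _ ⟨
    d * e * gcd b d         ≡⟨ cong (_* gcd b d) (ℕₚ.*-comm d e) ⟩
    m * gcd b d             ∎

-- Gauss's argument: the a ≤ m are sorted by the cofactor m / gcd(a, m). `count-gcd` gives the size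
-- of each class, and each of the m numbers lies in exactly one class.
∑-φ : ∀ {m N} → 1 ≤ m → m ≤ N → (∑[ d ← [1⋯ N ] ] 𝟙 (d ∣? m) *ᶻ + φ d) ≡ + m
∑-φ {m} {N} 1≤m m≤N = begin
  (∑[ d ← [1⋯ N ] ] 𝟙 (d ∣? m) *ᶻ + φ d)
    ≡⟨ ∑-divisors-truncate (+_ ∘ φ) 1≤m m≤N ⟩
  (∑[ d ← [1⋯ m ] ] 𝟙 (d ∣? m) *ᶻ + φ d)
    ≡⟨ ∑-cong∈ [1⋯ m ] (λ {d} d∈ → sym (count-gcd d m {{>-nonZero (proj₁ (∈-[1⋯]⁻ d∈))}})) ⟩
  (∑[ d ← [1⋯ m ] ] ∑[ a ← [1⋯ m ] ] 𝟙 (d * gcd a m ≟ m))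
    ≡⟨ ∑-swap [1⋯ m ] [1⋯ m ] _ ⟩
  (∑[ a ← [1⋯ m ] ] ∑[ d ← [1⋯ m ] ] 𝟙 (d * gcd a m ≟ m))
    ≡⟨ ∑-cong [1⋯ m ] unique-cofactor ⟩
  (∑[ a ← [1⋯ m ] ] 1ℤ)
    ≡⟨ ∑-one m ⟩
  + m ∎
  where
  instance
    m≢0 : NonZero m
    m≢0 = >-nonZero 1≤m
  unique-cofactor : ∀ a → (∑[ d ← [1⋯ m ] ] 𝟙 (d * gcd a m ≟ m)) ≡ 1ℤ
  unique-cofactor a with divides c m≡c*g ← gcd[m,n]∣n a m = begin
    (∑[ d ← [1⋯ m ] ] 𝟙 (d * gcd a m ≟ m))
      ≡⟨ ∑-cong [1⋯ m ] (λ d → trans (𝟙-cong (d * gcd a m ≟ m) (c ≟ d)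
           (λ eq → sym (ℕₚ.*-cancelʳ-≡ d c (gcd a m) (trans eq m≡c*g)))
           (λ { refl → sym m≡c*g }))
           (sym (ℤₚ.*-identityʳ _))) ⟩
    (∑[ d ← [1⋯ m ] ] 𝟙 (c ≟ d) *ᶻ 1ℤ)
      ≡⟨ ∑-delta (λ _ → 1ℤ) (ℕₚ.n≢0⇒n>0 c≢0) (∣⇒≤ (divides (gcd a m) (trans m≡c*g (ℕₚ.*-comm c _)))) ⟩
    1ℤ ∎
    where
    instance
      g≢0 : NonZero (gcd a m)
      g≢0 = ≢-nonZero (gcd[m,n]≢0 a m (inj₂ (≢-nonZero⁻¹ m)))
    c≢0 : c ≢ 0
    c≢0 refl = ≢-nonZero⁻¹ m m≡c*g

-- Subsets with a given gcd

-- The type `Subset m` fixes the ambient interval, so dilation by g would change the type; on lists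
-- of elements it is a plain `map`. Sublists without the head come first, just as `subsets` puts
-- outside before inside, so the two enumerations agree as lists.
sublists : List A → List (List A)
sublists []       = [ [] ]
sublists (x ∷ xs) = sublists xs ++ map (x ∷_) (sublists xs)

sublists-map : (e : A → B) (xs : List A) → sublists (map e xs) ≡ map (map e) (sublists xs)
sublists-map e []       = refl
sublists-map e (x ∷ xs) = begin
  sublists (map e xs) ++ map (e x ∷_) (sublists (map e xs))
    ≡⟨ cong (λ l → l ++ map (e x ∷_) l) (sublists-map e xs) ⟩
  map (map e) (sublists xs) ++ map (e x ∷_) (map (map e) (sublists xs))
    ≡⟨ cong (map (map e) (sublists xs) ++_) (trans (sym (map-∘ (sublists xs))) (map-∘ (sublists xs))) ⟩
  map (map e) (sublists xs) ++ map (map e) (map (x ∷_) (sublists xs))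
    ≡⟨ map-++ (map e) (sublists xs) _ ⟨
  map (map e) (sublists (x ∷ xs)) ∎

-- A sublist passes the test exactly when it avoids every rejected element. `h` stays arbitrary
-- because, when the head is accepted, the induction hypothesis is needed for `h ∘ (x ∷_)` as well.
∑-sublists-filter : {P : Pred A p} (P? : Decidable P) (xs : List A) (h : List A → ℤ) →
  (∑[ S ← sublists xs ] 𝟙 (all? P? S) *ᶻ h S) ≡ sumOver (sublists (filter P? xs)) h
∑-sublists-filter P? []       h = cong (_+ᶻ 0ℤ) (ℤₚ.*-identityˡ (h []))
∑-sublists-filter P? (x ∷ xs) h = begin
  sumOver (sublists xs ++ map (x ∷_) (sublists xs)) g
    ≡⟨ ∑-++ (sublists xs) _ g ⟩
  sumOver (sublists xs) g +ᶻ sumOver (map (x ∷_) (sublists xs)) g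
    ≡⟨ cong₂ _+ᶻ_ (∑-sublists-filter P? xs h) (∑-map (x ∷_) (sublists xs) g) ⟩
  sumOver (sublists (filter P? xs)) h +ᶻ sumOver (sublists xs) (g ∘ (x ∷_))
    ≡⟨ with-head ⟩
  sumOver (sublists (filter P? (x ∷ xs))) h ∎
  where
  g : List _ → ℤ
  g S = 𝟙 (all? P? S) *ᶻ h S
  with-head : sumOver (sublists (filter P? xs)) h +ᶻ sumOver (sublists xs) (g ∘ (x ∷_)) ≡
              sumOver (sublists (filter P? (x ∷ xs))) h
  with-head = go (P? x)
    where
    go : Dec _ → _
    go (yes px) = begin
      sumOver (sublists (filter P? xs)) h +ᶻ sumOver (sublists xs) (g ∘ (x ∷_))
        ≡⟨ cong (sumOver (sublists (filter P? xs)) h +ᶻ_) (∑-cong (sublists xs) (λ S → cong (_*ᶻ h (x ∷ S))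
             (𝟙-cong (all? P? (x ∷ S)) (all? P? S) (λ { (_ ∷ ps) → ps }) (px ∷_)))) ⟩
      sumOver (sublists (filter P? xs)) h +ᶻ (∑[ S ← sublists xs ] 𝟙 (all? P? S) *ᶻ h (x ∷ S))
        ≡⟨ cong (sumOver (sublists (filter P? xs)) h +ᶻ_) (∑-sublists-filter P? xs (h ∘ (x ∷_))) ⟩
      sumOver (sublists (filter P? xs)) h +ᶻ sumOver (sublists (filter P? xs)) (h ∘ (x ∷_))
        ≡⟨ cong (sumOver (sublists (filter P? xs)) h +ᶻ_) (∑-map (x ∷_) (sublists (filter P? xs)) h) ⟨
      sumOver (sublists (filter P? xs)) h +ᶻ sumOver (map (x ∷_) (sublists (filter P? xs))) h
        ≡⟨ ∑-++ (sublists (filter P? xs)) _ h ⟨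
      sumOver (sublists (x ∷ filter P? xs)) h
        ≡⟨ cong (λ ys → sumOver (sublists ys) h) (filter-accept P? px) ⟨
      sumOver (sublists (filter P? (x ∷ xs))) h ∎
    go (no ¬px) = begin
      sumOver (sublists (filter P? xs)) h +ᶻ sumOver (sublists xs) (g ∘ (x ∷_))
        ≡⟨ cong (sumOver (sublists (filter P? xs)) h +ᶻ_) (trans (∑-cong (sublists xs) (λ S → cong (_*ᶻ h (x ∷ S))
             (𝟙-false (all? P? (x ∷ S)) (λ { (px ∷ _) → ¬px px })))) (∑-zero (sublists xs))) ⟩
      sumOver (sublists (filter P? xs)) h +ᶻ 0ℤ
        ≡⟨ ℤₚ.+-identityʳ _ ⟩
      sumOver (sublists (filter P? xs)) h
        ≡⟨ cong (λ ys → sumOver (sublists ys) h) (filter-reject P? ¬px) ⟨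
      sumOver (sublists (filter P? (x ∷ xs))) h ∎

-- The first element is split off here, not the last as in `[1⋯suc_]`: a `Subset (suc m)` decides on
-- 1 first, and its tail stands for numbers shifted by one.
[1⋯_]-shift : ∀ m → [1⋯ suc m ] ≡ 1 ∷ map suc [1⋯ m ]
[1⋯ m ]-shift = cong (λ l → 1 ∷ map suc l) (sym (map-applyUpTo id suc m))

elements-tail : ∀ {m} b (A : Subset m) →
  map (λ i → suc (toℕ i)) (filter (_∈? (b Vec.∷ A)) (tabulate fsuc)) ≡ map suc (elements A)
elements-tail {m} b A = trans (cong (λ l → map (λ i → suc (toℕ i)) (filter (_∈? (b Vec.∷ A)) l)) (sym (map-tabulate id fsuc)))
                              (go (allFin m))
  where
  go : (is : List (Fin m)) → map (λ i → suc (toℕ i)) (filter (_∈? (b Vec.∷ A)) (map fsuc is)) ≡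
                             map suc (map (λ i → suc (toℕ i)) (filter (_∈? A) is))
  go []       = refl
  -- Membership of `fsuc i` in `b ∷ A` and of `i` in `A` are decided by the same boolean, so this
  -- split evaluates both filters.
  go (i ∷ is) with does (i ∈? A)
  ... | true  = cong (suc (suc (toℕ i)) ∷_) (go is)
  ... | false = go is

elements-outside : ∀ {m} (A : Subset m) → elements (outside Vec.∷ A) ≡ map suc (elements A)
elements-outside = elements-tail outside

elements-inside : ∀ {m} (A : Subset m) → elements (inside Vec.∷ A) ≡ 1 ∷ map suc (elements A)
elements-inside A = cong (1 ∷_) (elements-tail inside A)

map-elements-subsets : ∀ m → map elements (subsets m) ≡ sublists [1⋯ m ]
map-elements-subsets zero    = refl
map-elements-subsets (suc m) = begin
  map elements (map (outside Vec.∷_) (subsets m) ++ map (inside Vec.∷_) (subsets m))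
    ≡⟨ map-++ elements (map (outside Vec.∷_) (subsets m)) _ ⟩
  map elements (map (outside Vec.∷_) (subsets m)) ++ map elements (map (inside Vec.∷_) (subsets m))
    ≡⟨ cong₂ _++_ (trans (sym (map-∘ (subsets m))) (trans (map-cong elements-outside (subsets m)) (map-∘ (subsets m))))
                  (trans (sym (map-∘ (subsets m))) (trans (map-cong elements-inside (subsets m)) (trans (map-∘ (subsets m)) (cong (map (1 ∷_)) (map-∘ (subsets m)))))) ⟩
  map (map suc) (map elements (subsets m)) ++ map (1 ∷_) (map (map suc) (map elements (subsets m)))
    ≡⟨ cong (λ l → map (map suc) l ++ map (1 ∷_) (map (map suc) l)) (map-elements-subsets m) ⟩
  map (map suc) (sublists [1⋯ m ]) ++ map (1 ∷_) (map (map suc) (sublists [1⋯ m ]))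
    ≡⟨ cong (λ l → l ++ map (1 ∷_) l) (sublists-map suc [1⋯ m ]) ⟨
  sublists (1 ∷ map suc [1⋯ m ])
    ≡⟨ cong sublists [1⋯ m ]-shift ⟨
  sublists [1⋯ suc m ] ∎

length-elements : ∀ {m} (A : Subset m) → length (elements A) ≡ ∥ A ∥
length-elements Vec.[]              = refl
length-elements (inside Vec.∷ A)  = begin
  length (elements (inside Vec.∷ A)) ≡⟨ cong length (elements-inside A) ⟩
  suc (length (map suc (elements A))) ≡⟨ cong suc (length-map suc (elements A)) ⟩
  suc (length (elements A))           ≡⟨ cong suc (length-elements A) ⟩
  suc ∥ A ∥                           ∎
length-elements (outside Vec.∷ A) = begin
  length (elements (outside Vec.∷ A)) ≡⟨ cong length (elements-outside A) ⟩
  length (map suc (elements A))       ≡⟨ length-map suc (elements A) ⟩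
  length (elements A)                 ≡⟨ length-elements A ⟩
  ∥ A ∥                               ∎

-- The gcd of a list and its behaviour under dilation

gcds : List ℕ → ℕ
gcds = foldr gcd 0

gcds-scale : ∀ c xs → gcds (map (c *_) xs) ≡ c * gcds xs
gcds-scale c []       = sym (ℕₚ.*-zeroʳ c)
gcds-scale c (x ∷ xs) = trans (cong (gcd (c * x)) (gcds-scale c xs)) (sym (c*gcd[m,n]≡gcd[cm,cn] c x (gcds xs)))

gcds-∣ : ∀ xs → All (gcds xs ∣_) xs
gcds-∣ []       = []
gcds-∣ (x ∷ xs) = gcd[m,n]∣m x (gcds xs) ∷ All.map (∣-trans (gcd[m,n]∣n x (gcds xs))) (gcds-∣ xs)

-- Serves both ends of `count-gcdSet`: it leaves `Subset n` before the dilation and arrives at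
-- `Subset (n / g)` after it.
∑-subsetsOfSize : ∀ k m (h : ℕ → ℤ) →
  (∑[ A ← subsetsOfSize k m ] h (gcdSet A)) ≡ (∑[ S ← sublists [1⋯ m ] ] 𝟙 (length S ≟ k) *ᶻ h (gcds S))
∑-subsetsOfSize k m h = begin
  (∑[ A ← subsetsOfSize k m ] h (gcdSet A))
    ≡⟨ ∑-filter (λ A → ∥ A ∥ ≟ k) (subsets m) _ ⟩
  (∑[ A ← subsets m ] 𝟙 (∥ A ∥ ≟ k) *ᶻ h (gcdSet A))
    ≡⟨ ∑-cong (subsets m) (λ A → cong (λ l → 𝟙 (l ≟ k) *ᶻ h (gcdSet A)) (length-elements A)) ⟨
  (∑[ A ← subsets m ] 𝟙 (length (elements A) ≟ k) *ᶻ h (gcds (elements A)))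
    ≡⟨ ∑-map elements (subsets m) (λ S → 𝟙 (length S ≟ k) *ᶻ h (gcds S)) ⟨
  (∑[ S ← map elements (subsets m) ] 𝟙 (length S ≟ k) *ᶻ h (gcds S))
    ≡⟨ cong (λ l → ∑[ S ← l ] 𝟙 (length S ≟ k) *ᶻ h (gcds S)) (map-elements-subsets m) ⟩
  (∑[ S ← sublists [1⋯ m ] ] 𝟙 (length S ≟ k) *ᶻ h (gcds S)) ∎

count-gcdSet : ∀ k n g .{{_ : NonZero g}} → (∑[ A ← subsetsOfSize k n ] 𝟙 (gcdSet A ≟ g)) ≡ + f k (n / g)
count-gcdSet k n g = begin
  (∑[ A ← subsetsOfSize k n ] 𝟙 (gcdSet A ≟ g))
    ≡⟨ ∑-subsetsOfSize k n (λ x → 𝟙 (x ≟ g)) ⟩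
  (∑[ S ← sublists [1⋯ n ] ] w S)
    -- A gcd equal to g already makes every member a multiple of g. The redundant weight is inserted
    -- so that the ambient list can be cut down to the multiples.
    ≡⟨ ∑-cong (sublists [1⋯ n ]) all-multiples ⟩
  (∑[ S ← sublists [1⋯ n ] ] 𝟙 (all? (g ∣?_) S) *ᶻ w S)
    ≡⟨ ∑-sublists-filter (g ∣?_) [1⋯ n ] w ⟩
  sumOver (sublists (filter (g ∣?_) [1⋯ n ])) w
    ≡⟨ cong (λ xs → sumOver (sublists xs) w) (filter-multiples n g) ⟩
  sumOver (sublists (map (g *_) [1⋯ n / g ])) w
    ≡⟨ cong (λ xs → sumOver xs w) (sublists-map (g *_) [1⋯ n / g ]) ⟩
  sumOver (map (map (g *_)) (sublists [1⋯ n / g ])) w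
    ≡⟨ ∑-map (map (g *_)) (sublists [1⋯ n / g ]) w ⟩
  (∑[ S ← sublists [1⋯ n / g ] ] w (map (g *_) S))
    ≡⟨ ∑-cong (sublists [1⋯ n / g ]) rescale ⟩
  (∑[ S ← sublists [1⋯ n / g ] ] 𝟙 (length S ≟ k) *ᶻ 𝟙 (gcds S ≟ 1))
    ≡⟨ ∑-subsetsOfSize k (n / g) (λ x → 𝟙 (x ≟ 1)) ⟨
  (∑[ A ← subsetsOfSize k (n / g) ] 𝟙 (gcdSet A ≟ 1))
    ≡⟨ length-filter-∑ (λ A → gcdSet A ≟ 1) (subsetsOfSize k (n / g)) ⟨
  + f k (n / g) ∎
  where
  w : List ℕ → ℤ
  w S = 𝟙 (length S ≟ k) *ᶻ 𝟙 (gcds S ≟ g)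
  all-multiples : ∀ S → w S ≡ 𝟙 (all? (g ∣?_) S) *ᶻ w S
  all-multiples S = begin
    𝟙 (length S ≟ k) *ᶻ 𝟙 (gcds S ≟ g)
      ≡⟨ cong (𝟙 (length S ≟ k) *ᶻ_) (trans (𝟙-cong (gcds S ≟ g) (all? (g ∣?_) S ×-dec gcds S ≟ g)
           (λ eq → subst (λ x → All (x ∣_) S) eq (gcds-∣ S) , eq) proj₂) (𝟙-× (all? (g ∣?_) S) (gcds S ≟ g))) ⟩
    𝟙 (length S ≟ k) *ᶻ (𝟙 (all? (g ∣?_) S) *ᶻ 𝟙 (gcds S ≟ g))
      ≡⟨ x∙yz≈y∙xz (𝟙 (length S ≟ k)) (𝟙 (all? (g ∣?_) S)) (𝟙 (gcds S ≟ g)) ⟩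
    𝟙 (all? (g ∣?_) S) *ᶻ w S ∎
  rescale : ∀ S → w (map (g *_) S) ≡ 𝟙 (length S ≟ k) *ᶻ 𝟙 (gcds S ≟ 1)
  rescale S = cong₂ _*ᶻ_ (cong (λ l → 𝟙 (l ≟ k)) (length-map (g *_) S))
    (𝟙-cong (gcds (map (g *_) S) ≟ g) (gcds S ≟ 1)
      (λ eq → ℕₚ.*-cancelˡ-≡ (gcds S) 1 g (trans (sym (gcds-scale g S)) (trans eq (sym (ℕₚ.*-identityʳ g)))))
      (λ eq → trans (gcds-scale g S) (trans (cong (g *_) eq) (ℕₚ.*-identityʳ g))))

elements-bounds : ∀ {m x} (A : Subset m) → x ∈ elements A → 1 ≤ x × x ≤ m
elements-bounds A x∈ with i , _ , refl ← ∈-map⁻ (λ i → suc (toℕ i)) x∈ = s≤s z≤n , toℕ<n i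

gcds-bounds : ∀ {m} xs → 1 ≤ length xs → (∀ {x} → x ∈ xs → 1 ≤ x × x ≤ m) → 1 ≤ gcds xs × gcds xs ≤ m
gcds-bounds (x ∷ xs) _ bounds = ℕₚ.n≢0⇒n>0 (gcd[m,n]≢0 x (gcds xs) (inj₁ (ℕₚ.n>0⇒n≢0 1≤x))) ,
                                ℕₚ.≤-trans (∣⇒≤ {{>-nonZero 1≤x}} (gcd[m,n]∣m x (gcds xs))) (proj₂ (bounds (here refl)))
  where
  1≤x : 1 ≤ x
  1≤x = proj₁ (bounds (here refl))

-- Here k ≥ 1 enters: the empty set has `gcdSet` 0, which lies outside the range of g.
gcdSet-bounds : ∀ {k m} {A : Subset m} → 1 ≤ k → A ∈ subsetsOfSize k m → 1 ≤ gcdSet A × gcdSet A ≤ m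
gcdSet-bounds {k} {m} {A} 1≤k A∈ = gcds-bounds (elements A) (subst (1 ≤_) (sym size) 1≤k) (elements-bounds A)
  where
  size : length (elements A) ≡ k
  size = trans (length-elements A) (proj₂ (∈-filter⁻ (λ A → ∥ A ∥ ≟ k) {xs = subsets m} A∈))

-- Divisor sums of μ

SquareDivisible : ℕ → Set
SquareDivisible n = Any (λ p → p * p ∣ n) (primeDivisors n)

-- Spelled exactly as the test inside `μ`, so that a case split on it evaluates `μ n`.
squareDivisible? : ∀ n → Dec (SquareDivisible n)
squareDivisible? n = any? (λ p → p * p ∣? n) (primeDivisors n)

μ-square : ∀ n → SquareDivisible n → μ n ≡ 0ℤ
μ-square n sq with squareDivisible? n
... | yes _  = refl
... | no ¬sq = contradiction sq ¬sq

μ-squarefree : ∀ n → ¬ SquareDivisible n → μ n ≡ -1ℤ ^ᶻ length (primeDivisors n)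
μ-squarefree n ¬sq with squareDivisible? n
... | yes sq = contradiction sq ¬sq
... | no _   = refl

squareDivisible⁺ : ∀ {n p} .{{_ : NonZero n}} → Prime p → p * p ∣ n → SquareDivisible n
squareDivisible⁺ {n} {p} pp p²∣n = lose (∈-filter⁺ (λ p → prime? p ×-dec p ∣? n) (∈-[1⋯]⁺ 1≤p (∣⇒≤ p∣n)) (pp , p∣n)) p²∣n
  where
  p∣n : p ∣ n
  p∣n = m*n∣⇒m∣ p p p²∣n
  1≤p : 1 ≤ p
  1≤p = >-nonZero⁻¹ p {{prime⇒nonZero pp}}

squareDivisible⁻ : ∀ {n} → SquareDivisible n → ∃ λ p → Prime p × p * p ∣ n
squareDivisible⁻ {n} sq with p , p∈ , p²∣n ← find sq = p , proj₁ (proj₂ (∈-filter⁻ (λ p → prime? p ×-dec p ∣? n) {xs = [1⋯ n ]} p∈)) , p²∣n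

prime∣prime⇒≡ : ∀ {p q} → Prime p → Prime q → p ∣ q → p ≡ q
prime∣prime⇒≡ pp pq p∣q with prime⇒irreducible pq p∣q
... | inj₁ refl = contradiction pp ¬prime[1]
... | inj₂ p≡q  = p≡q

prime∤⇒coprime : ∀ {p d} → Prime p → ¬ p ∣ d → Coprime d p
prime∤⇒coprime pp p∤d (c∣d , c∣p) with prime⇒irreducible pp c∣p
... | inj₁ c≡1  = c≡1
... | inj₂ refl = contradiction c∣d p∤d

-- Let q be a prime with q² ∣ p e. If p divided q², then q = p, and cancelling p in p² ∣ p e would
-- give p ∣ e. So p is prime to q², and q² ∣ e.
squareDivisible-prime-*⁻ : ∀ {p e} .{{_ : NonZero e}} → Prime p → ¬ p ∣ e → SquareDivisible (p * e) → SquareDivisible e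
squareDivisible-prime-*⁻ {p} {e} pp p∤e sq with q , pq , q²∣pe ← squareDivisible⁻ sq =
  squareDivisible⁺ pq (coprime-divisor (prime∤⇒coprime pp p∤q²) q²∣pe)
  where
  p∤q² : ¬ p ∣ q * q
  p∤q² p∣q² with reduce (euclidsLemma q q pp p∣q²)
  ... | p∣q with refl ← prime∣prime⇒≡ pp pq p∣q = p∤e (*-cancelˡ-∣ p {{prime⇒nonZero pp}} q²∣pe)

-- Counting with indicators separates p, caught by a delta sum, from the primes dividing e; the
-- latter are at most e, which shrinks the range from p e to e.
length-primeDivisors-prime-* : ∀ {p e} .{{_ : NonZero e}} → Prime p → ¬ p ∣ e →
                               length (primeDivisors (p * e)) ≡ suc (length (primeDivisors e))
length-primeDivisors-prime-* {p} {e} pp p∤e = ℤₚ.+-injective (begin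
  + length (primeDivisors (p * e))
    ≡⟨ length-filter-∑ (λ q → prime? q ×-dec q ∣? (p * e)) [1⋯ p * e ] ⟩
  (∑[ q ← [1⋯ p * e ] ] 𝟙 (prime? q ×-dec q ∣? (p * e)))
    ≡⟨ ∑-cong [1⋯ p * e ] split ⟩
  (∑[ q ← [1⋯ p * e ] ] (𝟙 (p ≟ q) *ᶻ 1ℤ +ᶻ 𝟙 (prime? q ×-dec q ∣? e)))
    ≡⟨ ∑-distrib-+ [1⋯ p * e ] _ _ ⟩
  (∑[ q ← [1⋯ p * e ] ] 𝟙 (p ≟ q) *ᶻ 1ℤ) +ᶻ (∑[ q ← [1⋯ p * e ] ] 𝟙 (prime? q ×-dec q ∣? e))
    ≡⟨ cong₂ _+ᶻ_ (∑-delta (λ _ → 1ℤ) (>-nonZero⁻¹ p) (ℕₚ.m≤m*n p e))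
                  (∑-truncate _ (ℕₚ.m≤n*m e p) (λ q e<q → 𝟙-false (prime? q ×-dec q ∣? e) (λ { (_ , q∣e) → >⇒∤ e<q q∣e }))) ⟩
  1ℤ +ᶻ (∑[ q ← [1⋯ e ] ] 𝟙 (prime? q ×-dec q ∣? e))
    ≡⟨ cong (1ℤ +ᶻ_) (length-filter-∑ (λ q → prime? q ×-dec q ∣? e) [1⋯ e ]) ⟨
  + suc (length (primeDivisors e)) ∎)
  where
  instance
    p≢0 : NonZero p
    p≢0 = prime⇒nonZero pp
  split : ∀ q → 𝟙 (prime? q ×-dec q ∣? (p * e)) ≡ 𝟙 (p ≟ q) *ᶻ 1ℤ +ᶻ 𝟙 (prime? q ×-dec q ∣? e)
  split q = go (p ≟ q)
    where
    go : Dec (p ≡ q) → 𝟙 (prime? q ×-dec q ∣? (p * e)) ≡ 𝟙 (p ≟ q) *ᶻ 1ℤ +ᶻ 𝟙 (prime? q ×-dec q ∣? e)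
    go (yes refl) = trans (𝟙-true (prime? p ×-dec p ∣? (p * e)) (pp , m∣m*n e))
      (sym (cong₂ _+ᶻ_ (cong (_*ᶻ 1ℤ) (𝟙-true (p ≟ p) refl)) (𝟙-false (prime? p ×-dec p ∣? e) (p∤e ∘ proj₂))))
    go (no p≢q) = begin
      𝟙 (prime? q ×-dec q ∣? (p * e))
        ≡⟨ 𝟙-cong (prime? q ×-dec q ∣? (p * e)) (prime? q ×-dec q ∣? e) to (λ { (pq , q∣e) → pq , ∣n⇒∣m*n p q∣e }) ⟩
      𝟙 (prime? q ×-dec q ∣? e)
        ≡⟨ ℤₚ.+-identityˡ _ ⟨
      0ℤ *ᶻ 1ℤ +ᶻ 𝟙 (prime? q ×-dec q ∣? e)
        ≡⟨ cong (λ x → x *ᶻ 1ℤ +ᶻ 𝟙 (prime? q ×-dec q ∣? e)) (𝟙-false (p ≟ q) p≢q) ⟨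
      𝟙 (p ≟ q) *ᶻ 1ℤ +ᶻ 𝟙 (prime? q ×-dec q ∣? e) ∎
      where
      to : Prime q × q ∣ p * e → Prime q × q ∣ e
      to (pq , q∣pe) with euclidsLemma p e pq q∣pe
      ... | inj₁ q∣p = contradiction (sym (prime∣prime⇒≡ pq pp q∣p)) p≢q
      ... | inj₂ q∣e = pq , q∣e

μ-prime-*-∤ : ∀ {p} e .{{_ : NonZero e}} → Prime p → ¬ p ∣ e → μ (p * e) ≡ -ᶻ μ e
μ-prime-*-∤ {p} e pp p∤e = go (squareDivisible? e)
  where
  go : Dec (SquareDivisible e) → μ (p * e) ≡ -ᶻ μ e
  go (yes sq) with q , pq , q²∣e ← squareDivisible⁻ sq = begin
    μ (p * e) ≡⟨ μ-square (p * e) (squareDivisible⁺ {{m*n≢0 p e {{prime⇒nonZero pp}}}} pq (∣n⇒∣m*n p q²∣e)) ⟩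
    0ℤ        ≡⟨ cong -ᶻ_ (μ-square e sq) ⟨
    -ᶻ μ e    ∎
  go (no ¬sq) = begin
    μ (p * e)                                ≡⟨ μ-squarefree (p * e) (¬sq ∘ squareDivisible-prime-*⁻ pp p∤e) ⟩
    -1ℤ ^ᶻ length (primeDivisors (p * e))    ≡⟨ cong (-1ℤ ^ᶻ_) (length-primeDivisors-prime-* pp p∤e) ⟩
    -1ℤ *ᶻ (-1ℤ ^ᶻ length (primeDivisors e)) ≡⟨ cong (-1ℤ *ᶻ_) (μ-squarefree e ¬sq) ⟨
    -1ℤ *ᶻ μ e                               ≡⟨ ℤₚ.-1*i≡-i (μ e) ⟩
    -ᶻ μ e                                   ∎

-- If p ∣ e, then p² ∣ p e; otherwise p is one new prime factor and flips the sign. The indicator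
-- joins both cases in one formula, fit for termwise rewriting.
μ-prime-* : ∀ {p} e .{{_ : NonZero e}} → Prime p → μ (p * e) ≡ -ᶻ (𝟙 (¬? (p ∣? e)) *ᶻ μ e)
μ-prime-* {p} e pp with p ∣? e
... | yes p∣e = μ-square (p * e) (squareDivisible⁺ {{m*n≢0 p e {{prime⇒nonZero pp}}}} pp (*-monoʳ-∣ p p∣e))
... | no p∤e  = trans (μ-prime-*-∤ e pp p∤e) (cong -ᶻ_ (sym (ℤₚ.*-identityˡ (μ e))))

𝟙-split : (P? : Dec P) (x : ℤ) → x ≡ 𝟙 P? *ᶻ x +ᶻ 𝟙 (¬? P?) *ᶻ x
𝟙-split (yes _) x = sym (trans (ℤₚ.+-identityʳ _) (ℤₚ.*-identityˡ x))
𝟙-split (no _)  x = sym (trans (ℤₚ.+-identityˡ _) (ℤₚ.*-identityˡ x))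

-- For p ∤ e the divisor p e of p r cancels e, since e ∣ p r iff e ∣ r; the divisors divisible by p² have μ = 0.
∑-μ-prime-* : ∀ {p r} .{{_ : NonZero r}} → Prime p → (∑[ d ← [1⋯ p * r ] ] 𝟙 (d ∣? (p * r)) *ᶻ μ d) ≡ 0ℤ
∑-μ-prime-* {p} {r} pp = begin
  (∑[ d ← [1⋯ p * r ] ] g d)
    ≡⟨ ∑-cong [1⋯ p * r ] (λ d → 𝟙-split (p ∣? d) (g d)) ⟩
  (∑[ d ← [1⋯ p * r ] ] (𝟙 (p ∣? d) *ᶻ g d +ᶻ 𝟙 (¬? (p ∣? d)) *ᶻ g d))
    ≡⟨ ∑-distrib-+ [1⋯ p * r ] _ _ ⟩
  (∑[ d ← [1⋯ p * r ] ] 𝟙 (p ∣? d) *ᶻ g d) +ᶻ (∑[ d ← [1⋯ p * r ] ] 𝟙 (¬? (p ∣? d)) *ᶻ g d)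
    ≡⟨ cong₂ _+ᶻ_ divisible indivisible ⟩
  (∑[ e ← [1⋯ r ] ] -ᶻ h e) +ᶻ (∑[ e ← [1⋯ r ] ] h e)
    ≡⟨ ∑-distrib-+ [1⋯ r ] _ h ⟨
  (∑[ e ← [1⋯ r ] ] (-ᶻ h e +ᶻ h e))
    ≡⟨ ∑-cong [1⋯ r ] (λ e → ℤₚ.+-inverseˡ (h e)) ⟩
  (∑[ e ← [1⋯ r ] ] 0ℤ)
    ≡⟨ ∑-zero [1⋯ r ] ⟩
  0ℤ ∎
  where
  instance
    p≢0 : NonZero p
    p≢0 = prime⇒nonZero pp
  g h : ℕ → ℤ
  g d = 𝟙 (d ∣? (p * r)) *ᶻ μ d
  h e = 𝟙 (e ∣? r) *ᶻ (𝟙 (¬? (p ∣? e)) *ᶻ μ e)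
  divisible : (∑[ d ← [1⋯ p * r ] ] 𝟙 (p ∣? d) *ᶻ g d) ≡ (∑[ e ← [1⋯ r ] ] -ᶻ h e)
  divisible = begin
    (∑[ d ← [1⋯ p * r ] ] 𝟙 (p ∣? d) *ᶻ g d)
      ≡⟨ ∑-multiples (p * r) p g ⟩
    (∑[ e ← [1⋯ p * r / p ] ] g (p * e))
      ≡⟨ cong (λ m → ∑[ e ← [1⋯ m ] ] g (p * e)) (trans (cong (λ x → x / p) (ℕₚ.*-comm p r)) (m*n/n≡m r p)) ⟩
    (∑[ e ← [1⋯ r ] ] g (p * e))
      ≡⟨ ∑-cong∈ [1⋯ r ] (λ {e} e∈ → trans
           (cong₂ _*ᶻ_ (𝟙-cong (p * e ∣? (p * r)) (e ∣? r) (*-cancelˡ-∣ p) (*-monoʳ-∣ p))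
                       (μ-prime-* e {{>-nonZero (proj₁ (∈-[1⋯]⁻ e∈))}} pp))
           (sym (ℤₚ.neg-distribʳ-* (𝟙 (e ∣? r)) _))) ⟩
    (∑[ e ← [1⋯ r ] ] -ᶻ h e) ∎
  indivisible : (∑[ d ← [1⋯ p * r ] ] 𝟙 (¬? (p ∣? d)) *ᶻ g d) ≡ (∑[ e ← [1⋯ r ] ] h e)
  indivisible = begin
    (∑[ d ← [1⋯ p * r ] ] 𝟙 (¬? (p ∣? d)) *ᶻ g d)
      ≡⟨ ∑-cong [1⋯ p * r ] (λ d → trans
           (𝟙-*-cong (¬? (p ∣? d)) (λ p∤d → cong (_*ᶻ μ d)
             (𝟙-cong (d ∣? (p * r)) (d ∣? r) (coprime-divisor (prime∤⇒coprime pp p∤d)) (∣n⇒∣m*n p))))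
           (x∙yz≈y∙xz (𝟙 (¬? (p ∣? d))) (𝟙 (d ∣? r)) (μ d))) ⟩
    (∑[ d ← [1⋯ p * r ] ] h d)
      ≡⟨ ∑-divisors-truncate (λ d → 𝟙 (¬? (p ∣? d)) *ᶻ μ d) (>-nonZero⁻¹ r) (ℕₚ.m≤n*m r p) ⟩
    (∑[ e ← [1⋯ r ] ] h e) ∎

primeFactor : ∀ m .{{_ : NonZero m}} → m ≢ 1 → ∃ λ p → Prime p × p ∣ m
primeFactor m m≢1 with factorise m
... | record { factors = [] ; isFactorisation = m≡1 } = contradiction m≡1 m≢1
... | record { factors = p ∷ ps ; isFactorisation = m≡Π ; factorsPrime = pp ∷ _ } = p , pp , subst (p ∣_) (sym m≡Π) (m∣m*n (product ps))

-- For m ≠ 1 any prime factor p of m brings about the cancellation of `∑-μ-prime-*`; for m = 1 both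
-- sides compute to 1.
∑-μ : ∀ {m N} → 1 ≤ m → m ≤ N → (∑[ d ← [1⋯ N ] ] 𝟙 (d ∣? m) *ᶻ μ d) ≡ 𝟙 (m ≟ 1)
∑-μ {m} {N} 1≤m m≤N = trans (∑-divisors-truncate μ 1≤m m≤N) (go (m ≟ 1))
  where
  instance
    m≢0 : NonZero m
    m≢0 = >-nonZero 1≤m
  go : Dec (m ≡ 1) → (∑[ d ← [1⋯ m ] ] 𝟙 (d ∣? m) *ᶻ μ d) ≡ 𝟙 (m ≟ 1)
  go (yes refl) = refl
  go (no m≢1) with p , pp , divides r refl ← primeFactor m m≢1 =
    trans (cong (λ x → ∑[ d ← [1⋯ x ] ] 𝟙 (d ∣? x) *ᶻ μ d) (ℕₚ.*-comm r p))
          (trans (∑-μ-prime-* {r = r} {{ℕₚ.m*n≢0⇒m≢0 r}} pp) (sym (𝟙-false (m ≟ 1) m≢1)))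

-- The sum over g = (A)

M̄-by-gcd : ∀ n k → 1 ≤ k →
  + M̄ k n ≡ (∑[ g ← [1⋯ n ] ] (+ gcd (g ∸ 1) n *ᶻ 𝟙 (gcd g n ≟ 1)) *ᶻ + f k (n ÷ g))
M̄-by-gcd n k 1≤k = begin
  + M̄ k n
    ≡⟨ +sum≡∑ (filter (λ A → gcd (gcdSet A) n ≟ 1) (subsetsOfSize k n)) (λ A → gcd (gcdSet A ∸ 1) n) ⟩
  (∑[ A ← filter (λ A → gcd (gcdSet A) n ≟ 1) (subsetsOfSize k n) ] + gcd (gcdSet A ∸ 1) n)
    ≡⟨ ∑-filter (λ A → gcd (gcdSet A) n ≟ 1) (subsetsOfSize k n) (λ A → + gcd (gcdSet A ∸ 1) n) ⟩
  (∑[ A ← subsetsOfSize k n ] 𝟙 (gcd (gcdSet A) n ≟ 1) *ᶻ + gcd (gcdSet A ∸ 1) n)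
    -- The weight of A depends only on (A). It is spread over g by a delta sum, so that after the
    -- exchange each g carries the number of A with (A) = g.
    ≡⟨ ∑-cong∈ (subsetsOfSize k n) (λ {A} A∈ → trans (ℤₚ.*-comm (𝟙 (gcd (gcdSet A) n ≟ 1)) _) (sym (by-gcd A∈))) ⟩
  (∑[ A ← subsetsOfSize k n ] ∑[ g ← [1⋯ n ] ] 𝟙 (gcdSet A ≟ g) *ᶻ w g)
    ≡⟨ ∑-swap (subsetsOfSize k n) [1⋯ n ] _ ⟩
  (∑[ g ← [1⋯ n ] ] ∑[ A ← subsetsOfSize k n ] 𝟙 (gcdSet A ≟ g) *ᶻ w g)
    ≡⟨ ∑-cong∈ [1⋯ n ] (λ {g} g∈ → count g {{>-nonZero (proj₁ (∈-[1⋯]⁻ g∈))}}) ⟩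
  (∑[ g ← [1⋯ n ] ] w g *ᶻ + f k (n ÷ g)) ∎
  where
  w : ℕ → ℤ
  w g = + gcd (g ∸ 1) n *ᶻ 𝟙 (gcd g n ≟ 1)
  by-gcd : ∀ {A} → A ∈ subsetsOfSize k n → (∑[ g ← [1⋯ n ] ] 𝟙 (gcdSet A ≟ g) *ᶻ w g) ≡ w (gcdSet A)
  by-gcd A∈ with 1≤g , g≤n ← gcdSet-bounds 1≤k A∈ = ∑-delta w 1≤g g≤n
  count : ∀ g .{{_ : NonZero g}} → (∑[ A ← subsetsOfSize k n ] 𝟙 (gcdSet A ≟ g) *ᶻ w g) ≡ w g *ᶻ + f k (n ÷ g)
  count g = begin
    (∑[ A ← subsetsOfSize k n ] 𝟙 (gcdSet A ≟ g) *ᶻ w g)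
      ≡⟨ ∑-cong (subsetsOfSize k n) (λ A → ℤₚ.*-comm (𝟙 (gcdSet A ≟ g)) (w g)) ⟩
    (∑[ A ← subsetsOfSize k n ] w g *ᶻ 𝟙 (gcdSet A ≟ g))
      ≡⟨ ∑-distribˡ (w g) (subsetsOfSize k n) _ ⟨
    w g *ᶻ (∑[ A ← subsetsOfSize k n ] 𝟙 (gcdSet A ≟ g))
      ≡⟨ cong (w g *ᶻ_) (trans (count-gcdSet k n g) (cong (λ x → + f k x) (sym (÷≡/ n g)))) ⟩
    w g *ᶻ + f k (n ÷ g) ∎

-- δ ∣ g and g ≡ 1 (mod d) already force gcd(δ, d) = 1.
conditions-merge : ∀ n d δ g → 1 ≤ g →
  (𝟙 (d ∣? n) *ᶻ 𝟙 (δ ∣? n ×-dec gcd δ d ≟ 1)) *ᶻ (𝟙 (δ ∣? g) *ᶻ 𝟙 (g ≡? 1 [mod d ])) ≡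
  𝟙 (d ∣? gcd (g ∸ 1) n) *ᶻ 𝟙 (δ ∣? gcd g n)
conditions-merge n d δ g 1≤g = begin
  (𝟙 (d ∣? n) *ᶻ 𝟙 δ-cond) *ᶻ (𝟙 (δ ∣? g) *ᶻ 𝟙 (g ≡? 1 [mod d ]))
    ≡⟨ cong₂ _*ᶻ_ (𝟙-× (d ∣? n) δ-cond) (𝟙-× (δ ∣? g) (g ≡? 1 [mod d ])) ⟨
  𝟙 (d ∣? n ×-dec δ-cond) *ᶻ 𝟙 (δ ∣? g ×-dec g ≡? 1 [mod d ])
    ≡⟨ 𝟙-× (d ∣? n ×-dec δ-cond) (δ ∣? g ×-dec g ≡? 1 [mod d ]) ⟨
  𝟙 ((d ∣? n ×-dec δ-cond) ×-dec (δ ∣? g ×-dec g ≡? 1 [mod d ]))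
    ≡⟨ 𝟙-cong ((d ∣? n ×-dec δ-cond) ×-dec (δ ∣? g ×-dec g ≡? 1 [mod d ])) (d ∣? gcd (g ∸ 1) n ×-dec δ ∣? gcd g n) to from ⟩
  𝟙 (d ∣? gcd (g ∸ 1) n ×-dec δ ∣? gcd g n)
    ≡⟨ 𝟙-× (d ∣? gcd (g ∸ 1) n) (δ ∣? gcd g n) ⟩
  𝟙 (d ∣? gcd (g ∸ 1) n) *ᶻ 𝟙 (δ ∣? gcd g n) ∎
  where
  δ-cond : Dec (δ ∣ n × gcd δ d ≡ 1)
  δ-cond = δ ∣? n ×-dec gcd δ d ≟ 1
  ∣g-1∣≡g∸1 : ∣ g - 1 ∣ ≡ g ∸ 1
  ∣g-1∣≡g∸1 = ℕₚ.m≤n⇒∣n-m∣≡n∸m 1≤g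
  to : (d ∣ n × δ ∣ n × gcd δ d ≡ 1) × (δ ∣ g × g ≡ 1 [mod d ]) → d ∣ gcd (g ∸ 1) n × δ ∣ gcd g n
  to ((d∣n , δ∣n , _) , δ∣g , g≡1) = gcd-greatest (subst (d ∣_) ∣g-1∣≡g∸1 g≡1) d∣n , gcd-greatest δ∣g δ∣n
  from : d ∣ gcd (g ∸ 1) n × δ ∣ gcd g n → (d ∣ n × δ ∣ n × gcd δ d ≡ 1) × (δ ∣ g × g ≡ 1 [mod d ])
  from (d∣ , δ∣) = (∣-trans d∣ (gcd[m,n]∣n (g ∸ 1) n) , ∣-trans δ∣ (gcd[m,n]∣n g n) , coprime⇒gcd≡1 coprime) ,
                   δ∣g , subst (d ∣_) (sym ∣g-1∣≡g∸1) d∣g∸1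
    where
    d∣g∸1 : d ∣ g ∸ 1
    d∣g∸1 = ∣-trans d∣ (gcd[m,n]∣m (g ∸ 1) n)
    δ∣g : δ ∣ g
    δ∣g = ∣-trans δ∣ (gcd[m,n]∣m g n)
    -- A common divisor divides both g and g ∸ 1, and `1≤g` makes these differ by exactly 1.
    coprime : Coprime δ d
    coprime (c∣δ , c∣d) = ∣1⇒≡1 (∣m+n∣m⇒∣n (subst (_ ∣_) (sym (ℕₚ.m∸n+n≡m 1≤g)) (∣-trans c∣δ δ∣g)) (∣-trans c∣d d∣g∸1))

-- Exchanging the sums over d, δ and g

gather-conditions : ∀ a b c d e f g → a *ᶻ (b *ᶻ (c *ᶻ (d *ᶻ (e *ᶻ (f *ᶻ g))))) ≡ ((a *ᶻ c) *ᶻ (e *ᶻ f)) *ᶻ ((b *ᶻ d) *ᶻ g)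
gather-conditions = solve 7 (λ a b c d e f g → a :* (b :* (c :* (d :* (e :* (f :* g))))) := ((a :* c) :* (e :* f)) :* ((b :* d) :* g)) refl

-- Joins φ to the indicator in d and μ to the indicator in δ, the shape needed to split the double
-- sum into a product.
separate-factors : ∀ a b c d e → (a *ᶻ b) *ᶻ ((c *ᶻ d) *ᶻ e) ≡ e *ᶻ ((a *ᶻ c) *ᶻ (b *ᶻ d))
separate-factors = solve 5 (λ a b c d e → (a :* b) :* ((c :* d) :* e) := e :* ((a :* c) :* (b :* d))) refl

mainTheorem2 : (n k : ℕ) → 1 ≤ n → 1 ≤ k → k ≤ n →
    + M̄ k n ≡
    ∑ n (λ d → d ∣? n) (λ d →
    + φ d *ᶻ ∑ n (λ δ → δ ∣? n ×-dec gcd δ d ≟ 1) (λ δ {{_}} →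
    μ δ *ᶻ ∑ (n / δ) (λ j → δ * j ≡? 1 [mod d ]) (λ j {{_}} →
    + f k (_/_ n (j * δ) {{m*n≢0 j δ}}))))
mainTheorem2 n k 1≤n 1≤k _ = sym (begin
  ∑ n (λ d → d ∣? n) (λ d → d-term d)
    ≡⟨ ∑≡∑[1⋯] n (λ d → d ∣? n) (λ d → d-term d) (λ d → + φ d *ᶻ (∑[ δ ← [1⋯ n ] ] 𝟙 (δ-cond δ d) *ᶻ inner d δ)) (λ d′ →
         cong (+ φ (suc d′) *ᶻ_) (∑≡∑[1⋯] n (λ δ → δ-cond δ (suc d′)) (δ-term (suc d′)) (inner (suc d′)) (λ δ′ →
           cong (μ (suc δ′) *ᶻ_) (∑≡∑[1⋯] (n / suc δ′) (λ j → suc δ′ * j ≡? 1 [mod suc d′ ]) (j-term (suc δ′)) (λ j → F (suc δ′ * j)) (λ j′ →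
             -- The statement divides by `j * δ`; the reordering makes the summand a function of g =
             -- δ j.
             cong F (ℕₚ.*-comm (suc j′) (suc δ′))))))) ⟩
  (∑[ d ← [1⋯ n ] ] 𝟙 (d ∣? n) *ᶻ (+ φ d *ᶻ (∑[ δ ← [1⋯ n ] ] 𝟙 (δ-cond δ d) *ᶻ inner d δ)))
    ≡⟨ ∑-cong [1⋯ n ] distribute ⟩
  (∑[ d ← [1⋯ n ] ] ∑[ δ ← [1⋯ n ] ] ∑[ g ← [1⋯ n ] ] F g *ᶻ (U g d *ᶻ V g δ))
    -- The sum over g moves outermost in two exchanges, past δ and then past d.
    ≡⟨ ∑-cong [1⋯ n ] (λ d → ∑-swap [1⋯ n ] [1⋯ n ] _) ⟩
  (∑[ d ← [1⋯ n ] ] ∑[ g ← [1⋯ n ] ] ∑[ δ ← [1⋯ n ] ] F g *ᶻ (U g d *ᶻ V g δ))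
    ≡⟨ ∑-swap [1⋯ n ] [1⋯ n ] _ ⟩
  (∑[ g ← [1⋯ n ] ] ∑[ d ← [1⋯ n ] ] ∑[ δ ← [1⋯ n ] ] F g *ᶻ (U g d *ᶻ V g δ))
    ≡⟨ ∑-cong [1⋯ n ] factor ⟩
  (∑[ g ← [1⋯ n ] ] (sumOver [1⋯ n ] (U g) *ᶻ sumOver [1⋯ n ] (V g)) *ᶻ F g)
    -- Both gcds lie between 1 and n, the first even at g = 1 because n ≥ 1, so the divisor sums
    -- over `[1⋯ n ]` are complete.
    ≡⟨ ∑-cong [1⋯ n ] (λ g → cong (_*ᶻ F g) (cong₂ _*ᶻ_ (∑-φ (gcd>0 (g ∸ 1)) (gcd[m,n]≤n (g ∸ 1) n)) (∑-μ (gcd>0 g) (gcd[m,n]≤n g n)))) ⟩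
  (∑[ g ← [1⋯ n ] ] (+ gcd (g ∸ 1) n *ᶻ 𝟙 (gcd g n ≟ 1)) *ᶻ F g)
    ≡⟨ M̄-by-gcd n k 1≤k ⟨
  + M̄ k n ∎)
  where
  instance
    n≢0 : NonZero n
    n≢0 = >-nonZero 1≤n
  gcd>0 : ∀ x → 1 ≤ gcd x n
  gcd>0 x = ℕₚ.n≢0⇒n>0 (gcd[m,n]≢0 x n (inj₂ (≢-nonZero⁻¹ n)))
  F : ℕ → ℤ
  F g = + f k (n ÷ g)
  U V : ℕ → ℕ → ℤ
  U g d = 𝟙 (d ∣? gcd (g ∸ 1) n) *ᶻ + φ d
  V g δ = 𝟙 (δ ∣? gcd g n) *ᶻ μ δ
  δ-cond : ∀ δ d → Dec (δ ∣ n × gcd δ d ≡ 1)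
  δ-cond δ d = δ ∣? n ×-dec gcd δ d ≟ 1
  j-term : (δ : ℕ) .{{_ : NonZero δ}} (j : ℕ) → .{{NonZero j}} → ℤ
  j-term δ j = + f k (_/_ n (j * δ) {{m*n≢0 j δ}})
  δ-term : (d δ : ℕ) → .{{NonZero δ}} → ℤ
  δ-term d δ = μ δ *ᶻ ∑ (n / δ) (λ j → δ * j ≡? 1 [mod d ]) (j-term δ)
  d-term : ℕ → ℤ
  d-term d = + φ d *ᶻ ∑ n (λ δ → δ-cond δ d) (δ-term d)
  inner : ℕ → ℕ → ℤ
  inner d δ = μ δ *ᶻ (∑[ j ← [1⋯ n ÷ δ ] ] 𝟙 (δ * j ≡? 1 [mod d ]) *ᶻ F (δ * j))

  -- The substitution g = δ j replaces the range n / δ by one free of δ, as the exchange of sums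
  -- demands.
  inner-multiples : ∀ d δ .{{_ : NonZero δ}} →
    inner d δ ≡ (∑[ g ← [1⋯ n ] ] μ δ *ᶻ (𝟙 (δ ∣? g) *ᶻ (𝟙 (g ≡? 1 [mod d ]) *ᶻ F g)))
  inner-multiples d δ = begin
    inner d δ
      ≡⟨ cong (λ m → μ δ *ᶻ (∑[ j ← [1⋯ m ] ] 𝟙 (δ * j ≡? 1 [mod d ]) *ᶻ F (δ * j))) (÷≡/ n δ) ⟩
    μ δ *ᶻ (∑[ j ← [1⋯ n / δ ] ] 𝟙 (δ * j ≡? 1 [mod d ]) *ᶻ F (δ * j))
      ≡⟨ cong (μ δ *ᶻ_) (∑-multiples n δ (λ g → 𝟙 (g ≡? 1 [mod d ]) *ᶻ F g)) ⟨
    μ δ *ᶻ (∑[ g ← [1⋯ n ] ] 𝟙 (δ ∣? g) *ᶻ (𝟙 (g ≡? 1 [mod d ]) *ᶻ F g))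
      ≡⟨ ∑-distribˡ (μ δ) [1⋯ n ] _ ⟩
    (∑[ g ← [1⋯ n ] ] μ δ *ᶻ (𝟙 (δ ∣? g) *ᶻ (𝟙 (g ≡? 1 [mod d ]) *ᶻ F g))) ∎

  summand : ∀ d δ {g} → 1 ≤ g →
    𝟙 (d ∣? n) *ᶻ (+ φ d *ᶻ (𝟙 (δ-cond δ d) *ᶻ (μ δ *ᶻ (𝟙 (δ ∣? g) *ᶻ (𝟙 (g ≡? 1 [mod d ]) *ᶻ F g))))) ≡
    F g *ᶻ (U g d *ᶻ V g δ)
  summand d δ {g} 1≤g = begin
    _
      ≡⟨ gather-conditions (𝟙 (d ∣? n)) (+ φ d) (𝟙 (δ-cond δ d)) (μ δ) (𝟙 (δ ∣? g)) (𝟙 (g ≡? 1 [mod d ])) (F g) ⟩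
    ((𝟙 (d ∣? n) *ᶻ 𝟙 (δ-cond δ d)) *ᶻ (𝟙 (δ ∣? g) *ᶻ 𝟙 (g ≡? 1 [mod d ]))) *ᶻ ((+ φ d *ᶻ μ δ) *ᶻ F g)
      ≡⟨ cong (_*ᶻ ((+ φ d *ᶻ μ δ) *ᶻ F g)) (conditions-merge n d δ g 1≤g) ⟩
    (𝟙 (d ∣? gcd (g ∸ 1) n) *ᶻ 𝟙 (δ ∣? gcd g n)) *ᶻ ((+ φ d *ᶻ μ δ) *ᶻ F g)
      ≡⟨ separate-factors (𝟙 (d ∣? gcd (g ∸ 1) n)) (𝟙 (δ ∣? gcd g n)) (+ φ d) (μ δ) (F g) ⟩
    F g *ᶻ (U g d *ᶻ V g δ) ∎

  distribute : ∀ d → 𝟙 (d ∣? n) *ᶻ (+ φ d *ᶻ (∑[ δ ← [1⋯ n ] ] 𝟙 (δ-cond δ d) *ᶻ inner d δ)) ≡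
                     (∑[ δ ← [1⋯ n ] ] ∑[ g ← [1⋯ n ] ] F g *ᶻ (U g d *ᶻ V g δ))
  distribute d = begin
    𝟙 (d ∣? n) *ᶻ (+ φ d *ᶻ (∑[ δ ← [1⋯ n ] ] 𝟙 (δ-cond δ d) *ᶻ inner d δ))
      ≡⟨ cong (𝟙 (d ∣? n) *ᶻ_) (∑-distribˡ (+ φ d) [1⋯ n ] _) ⟩
    𝟙 (d ∣? n) *ᶻ (∑[ δ ← [1⋯ n ] ] + φ d *ᶻ (𝟙 (δ-cond δ d) *ᶻ inner d δ))
      ≡⟨ ∑-distribˡ (𝟙 (d ∣? n)) [1⋯ n ] _ ⟩
    (∑[ δ ← [1⋯ n ] ] 𝟙 (d ∣? n) *ᶻ (+ φ d *ᶻ (𝟙 (δ-cond δ d) *ᶻ inner d δ)))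
      ≡⟨ ∑-cong∈ [1⋯ n ] (λ {δ} δ∈ → push δ {{>-nonZero (proj₁ (∈-[1⋯]⁻ δ∈))}}) ⟩
    (∑[ δ ← [1⋯ n ] ] ∑[ g ← [1⋯ n ] ] F g *ᶻ (U g d *ᶻ V g δ)) ∎
    where
    push : ∀ δ .{{_ : NonZero δ}} → 𝟙 (d ∣? n) *ᶻ (+ φ d *ᶻ (𝟙 (δ-cond δ d) *ᶻ inner d δ)) ≡
                                    (∑[ g ← [1⋯ n ] ] F g *ᶻ (U g d *ᶻ V g δ))
    push δ = begin
      𝟙 (d ∣? n) *ᶻ (+ φ d *ᶻ (𝟙 (δ-cond δ d) *ᶻ inner d δ))
        ≡⟨ cong (λ x → 𝟙 (d ∣? n) *ᶻ (+ φ d *ᶻ (𝟙 (δ-cond δ d) *ᶻ x))) (inner-multiples d δ) ⟩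
      𝟙 (d ∣? n) *ᶻ (+ φ d *ᶻ (𝟙 (δ-cond δ d) *ᶻ sumOver [1⋯ n ] t))
        ≡⟨ cong (λ x → 𝟙 (d ∣? n) *ᶻ (+ φ d *ᶻ x)) (∑-distribˡ (𝟙 (δ-cond δ d)) [1⋯ n ] t) ⟩
      𝟙 (d ∣? n) *ᶻ (+ φ d *ᶻ (∑[ g ← [1⋯ n ] ] 𝟙 (δ-cond δ d) *ᶻ t g))
        ≡⟨ cong (𝟙 (d ∣? n) *ᶻ_) (∑-distribˡ (+ φ d) [1⋯ n ] _) ⟩
      𝟙 (d ∣? n) *ᶻ (∑[ g ← [1⋯ n ] ] + φ d *ᶻ (𝟙 (δ-cond δ d) *ᶻ t g))
        ≡⟨ ∑-distribˡ (𝟙 (d ∣? n)) [1⋯ n ] _ ⟩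
      (∑[ g ← [1⋯ n ] ] 𝟙 (d ∣? n) *ᶻ (+ φ d *ᶻ (𝟙 (δ-cond δ d) *ᶻ t g)))
        ≡⟨ ∑-cong∈ [1⋯ n ] (λ g∈ → summand d δ (proj₁ (∈-[1⋯]⁻ g∈))) ⟩
      (∑[ g ← [1⋯ n ] ] F g *ᶻ (U g d *ᶻ V g δ)) ∎
      where
      t : ℕ → ℤ
      t g = μ δ *ᶻ (𝟙 (δ ∣? g) *ᶻ (𝟙 (g ≡? 1 [mod d ]) *ᶻ F g))

  factor : ∀ g → (∑[ d ← [1⋯ n ] ] ∑[ δ ← [1⋯ n ] ] F g *ᶻ (U g d *ᶻ V g δ)) ≡
                 (sumOver [1⋯ n ] (U g) *ᶻ sumOver [1⋯ n ] (V g)) *ᶻ F g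
  factor g = begin
    (∑[ d ← [1⋯ n ] ] ∑[ δ ← [1⋯ n ] ] F g *ᶻ (U g d *ᶻ V g δ))
      ≡⟨ ∑-cong [1⋯ n ] (λ d → trans (sym (∑-distribˡ (F g) [1⋯ n ] _)) (cong (F g *ᶻ_) (trans
           (sym (∑-distribˡ (U g d) [1⋯ n ] (V g))) (ℤₚ.*-comm (U g d) _)))) ⟩
    (∑[ d ← [1⋯ n ] ] F g *ᶻ (sumOver [1⋯ n ] (V g) *ᶻ U g d))
      ≡⟨ ∑-distribˡ (F g) [1⋯ n ] _ ⟨
    F g *ᶻ (∑[ d ← [1⋯ n ] ] sumOver [1⋯ n ] (V g) *ᶻ U g d)
      ≡⟨ cong (F g *ᶻ_) (∑-distribˡ (sumOver [1⋯ n ] (V g)) [1⋯ n ] (U g)) ⟨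
    F g *ᶻ (sumOver [1⋯ n ] (V g) *ᶻ sumOver [1⋯ n ] (U g))
      ≡⟨ x∙yz≈zy∙x (F g) (sumOver [1⋯ n ] (V g)) (sumOver [1⋯ n ] (U g)) ⟩
    (sumOver [1⋯ n ] (U g) *ᶻ sumOver [1⋯ n ] (V g)) *ᶻ F g ∎
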